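{- Randomly assigning each job to one of the two machines, independently with equal probability $\tfrac12$, is a $3/2$-approximation for SM2; that is, for every instance of SM2, the expected value of $\sum_{i=1}^k\max\{p(A\cap S_i),p(\bar A\cap S_i)\}$, where $A$ is the random set of jobs assigned to machine 1 and $\bar A=J\setminus A$ is the set of jobs assigned to machine 2, is at most $\tfrac32$ times the optimal value of the instance.
   Context: An instance of SM2 consists of a finite set $J$ of jobs, a processing time $p_j\ge 0$ for each $j\in J$, and a collection $\mathcal S=\{S_1,\dots,S_k\}$ of scenarios, each scenario $S_i$ being a subset of $J$. For $S\subseteq J$ write $p(S)=\sum_{j\in S}p_j$. A solution is a partition $(A,\bar A)$ of $J$ (jobs in $A$ go to machine 1 and jobs in $\bar A$ go to machine 2; the same assignment is used in all scenarios; a part may be empty). SM2 asks for a partition minimizing the sum of makespans $\sum_{i=1}^k\max\{p(A\cap S_i),p(\bar A\cap S_i)\}$. -}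

module Defs where

open import Level using (Level; 0ℓ; _⊔_) renaming (suc to lsuc)
open import Algebra.Bundles using (CommutativeRing)
open import Algebra.Structures using (IsCommutativeRing)
open import Algebra.Core using (Op₁; Op₂)
import Algebra.Definitions
import Algebra.Properties.CommutativeMonoid.Sum as BigOp
import Algebra.Properties.Ring as RingProperties
import Algebra.Construct.NaturalChoice.Max as Max
open import Data.Bool.Base using (if_then_else_)
open import Data.Fin.Base using (Fin)
open import Data.Fin.Subset using (Subset; Side; inside; outside; _∩_; ∁) renaming (⊥ to ∅)
open import Data.List.Base using (List; []; _∷_; _++_; map; foldr)
import Data.List.Extrema as Extrema
open import Data.List.Membership.Propositional using (_∈_)
open import Data.List.Membership.Propositional.Properties using (∈-map⁺; ∈-map⁻; ∈-++⁺ˡ; ∈-++⁺ʳ)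
open import Data.List.Relation.Unary.All using ([])
open import Data.List.Relation.Unary.Any using (here)
open import Data.List.Relation.Unary.AllPairs using ([]; _∷_)
open import Data.List.Relation.Unary.Unique.Propositional using (Unique)
import Data.List.Relation.Unary.Unique.Propositional.Properties as Unique
open import Data.Nat.Base using (ℕ; zero; suc)
open import Data.Empty using (⊥)
open import Data.Product.Base using (∃; _×_; _,_; proj₁)
open import Data.Sum.Base using (inj₁; inj₂)
open import Data.Vec.Base using ([]; _∷_; lookup)
open import Data.Vec.Properties using (∷-injectiveʳ)
import Data.Rational.Base as ℚ
import Data.Rational.Properties as ℚ
open import Relation.Binary.Bundles using (TotalOrder)
open import Relation.Binary.Core using (Rel)
open import Relation.Binary.PropositionalEquality using (_≡_; refl)
open import Relation.Binary.Structures using (IsTotalOrder)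
import Relation.Binary.Reasoning.PartialOrder as ≤-Reasoning
open import Relation.Nullary using (¬_)

-- Processing times live in an arbitrary linearly ordered field, so that both
-- the rationals and the (classical) real numbers are covered.

record OrderedField c ℓ₁ ℓ₂ : Set (lsuc (c ⊔ ℓ₁ ⊔ ℓ₂)) where
  infix  8 -_
  infixl 7 _*_
  infixl 6 _+_
  infix  4 _≈_ _≤_
  field
    Carrier           : Set c
    _≈_               : Rel Carrier ℓ₁
    _≤_               : Rel Carrier ℓ₂
    _+_ _*_           : Op₂ Carrier
    -_                : Op₁ Carrier
    0# 1#             : Carrier
    isCommutativeRing : IsCommutativeRing _≈_ _+_ _*_ -_ 0# 1#
    isTotalOrder      : IsTotalOrder _≈_ _≤_
    +-monoʳ-≤         : ∀ x {y z} → y ≤ z → x + y ≤ x + z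
    *-nonNeg          : ∀ {x y} → 0# ≤ x → 0# ≤ y → 0# ≤ x * y
    0≉1               : ¬ 0# ≈ 1#
    ≉0⇒invertible     : ∀ {x} → ¬ x ≈ 0# → Algebra.Definitions.Invertible _≈_ 1# _*_ x

  commutativeRing : CommutativeRing c ℓ₁
  commutativeRing = record { isCommutativeRing = isCommutativeRing }

  totalOrder : TotalOrder c ℓ₁ ℓ₂
  totalOrder = record { isTotalOrder = isTotalOrder }

  open CommutativeRing commutativeRing public
    using (ring; *-commutativeMonoid; +-commutativeMonoid)
  open Max totalOrder public using () renaming (_⊔_ to max)

  private
    module R = CommutativeRing commutativeRing
    module O = TotalOrder totalOrder
    module RP = RingProperties ring
    open ≤-Reasoning O.poset

  0≤1 : 0# ≤ 1#
  0≤1 with O.total 0# 1#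
  ... | inj₁ 0≤1 = 0≤1
  ... | inj₂ 1≤0 = begin
    0#            ≤⟨ *-nonNeg 0≤-1 0≤-1 ⟩
    - 1# * - 1#   ≈⟨ RP.-1*x≈-x (- 1#) ⟩
    - (- 1#)      ≈⟨ RP.-‿involutive 1# ⟩
    1#            ∎
    where
    0≤-1 : 0# ≤ - 1#
    0≤-1 = begin
      0#          ≈⟨ R.-‿inverseˡ 1# ⟨
      - 1# + 1#   ≤⟨ +-monoʳ-≤ (- 1#) 1≤0 ⟩
      - 1# + 0#   ≈⟨ R.+-identityʳ (- 1#) ⟩
      - 1#        ∎

  2# 3# : Carrier
  2# = 1# + 1#
  3# = 2# + 1#

  2≉0 : ¬ 2# ≈ 0#
  2≉0 2≈0 = 0≉1 (O.antisym 0≤1 (begin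
    1#        ≈⟨ R.+-identityʳ 1# ⟨
    1# + 0#   ≤⟨ +-monoʳ-≤ 1# 0≤1 ⟩
    1# + 1#   ≈⟨ 2≈0 ⟩
    0#        ∎))

  ½ : Carrier
  ½ = proj₁ (≉0⇒invertible 2≉0)

ℚ-orderedField : OrderedField 0ℓ 0ℓ 0ℓ
ℚ-orderedField = record
  { isCommutativeRing = ℚ.+-*-isCommutativeRing
  ; isTotalOrder      = ℚ.≤-isTotalOrder
  ; +-monoʳ-≤         = λ x → ℚ.+-monoʳ-≤ x
  ; *-nonNeg          = λ {p} {q} 0≤p 0≤q → ℚ.nonNegative⁻¹ (p ℚ.* q)
      {{ℚ.nonNeg*nonNeg⇒nonNeg p {{ℚ.nonNegative 0≤p}} q {{ℚ.nonNegative 0≤q}}}}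
  ; 0≉1               = λ ()
  ; ≉0⇒invertible     = λ {p} p≢0 → let instance _ = ℚ.≢-nonZero p≢0 in
      ℚ.1/ p , ℚ.*-inverseˡ p , ℚ.*-inverseʳ p
  }

allSubsets : ∀ n → List (Subset n)
allSubsets zero    = [] ∷ []
allSubsets (suc n) = map (inside ∷_) (allSubsets n) ++ map (outside ∷_) (allSubsets n)

∈-allSubsets : ∀ {n} (A : Subset n) → A ∈ allSubsets n
∈-allSubsets []            = here refl
∈-allSubsets (inside  ∷ A) = ∈-++⁺ˡ (∈-map⁺ (inside ∷_) (∈-allSubsets A))
∈-allSubsets (outside ∷ A) =
  ∈-++⁺ʳ (map (inside ∷_) (allSubsets _)) (∈-map⁺ (outside ∷_) (∈-allSubsets A))

allSubsets-unique : ∀ n → Unique (allSubsets n)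
allSubsets-unique zero    = [] ∷ []
allSubsets-unique (suc n) = Unique.++⁺
  (Unique.map⁺ ∷-injectiveʳ (allSubsets-unique n))
  (Unique.map⁺ ∷-injectiveʳ (allSubsets-unique n))
  λ (A∈ins , A∈out) → disjoint (∈-map⁻ (inside ∷_) A∈ins) (∈-map⁻ (outside ∷_) A∈out)
  where
  disjoint : ∀ {A : Subset (suc n)} →
             (∃ λ B → B ∈ allSubsets n × A ≡ inside ∷ B) →
             (∃ λ B → B ∈ allSubsets n × A ≡ outside ∷ B) → ⊥
  disjoint (_ , _ , refl) (_ , _ , ())

module _ {c ℓ₁ ℓ₂} (F : OrderedField c ℓ₁ ℓ₂) where
  open OrderedField F
  open BigOp +-commutativeMonoid using (sum)
  open BigOp *-commutativeMonoid using () renaming (sum to product)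

  -- The jobs are the elements of Fin #jobs.
  record SM2 : Set (c ⊔ ℓ₂) where
    field
      #jobs         : ℕ
      time          : Fin #jobs → Carrier
      time-nonNeg   : ∀ j → 0# ≤ time j
      #scenarios    : ℕ
      scenario      : Fin #scenarios → Subset #jobs

    totalTime : Subset #jobs → Carrier
    totalTime S = sum λ j → if lookup S j then time j else 0#

    -- A subset A stands for the partition (A , ∁ A).
    sumOfMakespans : Subset #jobs → Carrier
    sumOfMakespans A = sum λ i →
      max (totalTime (A ∩ scenario i)) (totalTime (∁ A ∩ scenario i))

    -- The fold needs a default value; the cost of one particular partition,
    -- which is in the list anyway, leaves the minimum unchanged.
    optimalValue : Carrier
    optimalValue = Extrema.min totalOrder (sumOfMakespans ∅)
                     (map sumOfMakespans (allSubsets #jobs))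

  Pr[job-on_] : Side → Carrier
  Pr[job-on inside  ] = ½
  Pr[job-on outside ] = ½

  -- By independence, the probability of an outcome is a product over the jobs.
  Pr : ∀ {n} → Subset n → Carrier
  Pr A = product λ j → Pr[job-on lookup A j ]

  𝔼 : ∀ {n} → (Subset n → Carrier) → Carrier
  𝔼 {n} X = foldr _+_ 0# (map (λ A → Pr A * X A) (allSubsets n))

{-# OPTIONS --safe #-}
module Submission where

-- Fix a partition (B , ∁ B).  If A is uniformly random, then so is the subset
-- A ⊕ B obtained by moving every job of B to the other machine.  Pairing A with
-- A ⊕ B gives, in each scenario, two makespans whose sum is at most three times
-- the makespan of (B , ∁ B): when added, the loads of the two machines involved
-- cover one of the parts B and ∁ B exactly once and a subset of the other twice.
-- Hence twice the expected cost is at most three times the cost of any B.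

open import Defs
open import Algebra.Bundles using (CommutativeRing)
import Algebra.Construct.NaturalChoice.Max as Max
import Algebra.Lattice.Properties.BooleanAlgebra as BooleanAlgebra
import Algebra.Properties.CommutativeSemigroup as CommutativeSemigroup
import Algebra.Properties.Semiring.Sum as Sum
open import Data.Bool.Base using (true; false; not; _∧_; _xor_; if_then_else_)
open import Data.Fin.Base using (Fin; zero; suc)
open import Data.Fin.Subset using (Subset; inside; outside; _∩_; ∁) renaming (⊥ to ∅)
open import Data.Fin.Subset.Properties using (∩-assoc; ∩-comm; ∪-∩-booleanAlgebra)
open import Data.List.Base using (List; []; _∷_; _++_; map; foldr)
import Data.List.Extrema as Extrema
open import Data.List.Properties using (map-∘)
open import Data.List.Relation.Unary.All using (universal)
import Data.List.Relation.Unary.All.Properties as All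
open import Data.Nat.Base using (zero; suc)
open import Data.Product.Base using (proj₁; proj₂)
open import Data.Sum.Base using (inj₁; inj₂)
open import Data.Vec.Base using ([]; _∷_; lookup; zipWith)
open import Function.Base using (_∘_; id)
open import Relation.Binary.Bundles using (TotalOrder)
open import Relation.Binary.PropositionalEquality as ≡ using (_≡_; cong; cong₂)
import Relation.Binary.Reasoning.PartialOrder as ≤-Reasoning

-- Symmetric difference of subsets.

infixl 6 _⊕_

_⊕_ : ∀ {n} → Subset n → Subset n → Subset n
_⊕_ = zipWith _xor_

∁-involutive : ∀ {n} (A : Subset n) → ∁ (∁ A) ≡ A
∁-involutive {n} = BooleanAlgebra.¬-involutive (∪-∩-booleanAlgebra n)

-- Complementing amounts to adding the full set with `_⊕_`, so it commutes with adding `B`.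
-- Statements about machine 1 thereby carry over to machine 2.
∁-⊕ : ∀ {n} (A B : Subset n) → ∁ (A ⊕ B) ≡ ∁ A ⊕ B
∁-⊕ []      []      = ≡.refl
∁-⊕ (a ∷ A) (b ∷ B) = cong₂ _∷_ (not-xor a b) (∁-⊕ A B)
  where
  not-xor : ∀ x y → not (x xor y) ≡ not x xor y
  not-xor true  true  = ≡.refl
  not-xor true  false = ≡.refl
  not-xor false y     = ≡.refl

-- Every job of `B` changes machine, so within `B` membership is negated.
⊕-∩-inside : ∀ {n} (A B S : Subset n) → (A ⊕ B) ∩ (B ∩ S) ≡ ∁ A ∩ (B ∩ S)
⊕-∩-inside []      []      []      = ≡.refl
⊕-∩-inside (a ∷ A) (b ∷ B) (s ∷ S) = cong₂ _∷_ (xor-∧ a b s) (⊕-∩-inside A B S)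
  where
  xor-∧ : ∀ x y z → (x xor y) ∧ (y ∧ z) ≡ not x ∧ (y ∧ z)
  xor-∧ true  true  z = ≡.refl
  xor-∧ true  false z = ≡.refl
  xor-∧ false true  z = ≡.refl
  xor-∧ false false z = ≡.refl

-- Jobs outside `B` stay where they are.
⊕-∩-outside : ∀ {n} (A B S : Subset n) → (A ⊕ B) ∩ (∁ B ∩ S) ≡ A ∩ (∁ B ∩ S)
⊕-∩-outside []      []      []      = ≡.refl
⊕-∩-outside (a ∷ A) (b ∷ B) (s ∷ S) = cong₂ _∷_ (xor-∧ a b s) (⊕-∩-outside A B S)
  where
  xor-∧ : ∀ x y z → (x xor y) ∧ (not y ∧ z) ≡ x ∧ (not y ∧ z)
  xor-∧ true  true  z = ≡.refl
  xor-∧ true  false z = ≡.refl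
  xor-∧ false true  z = ≡.refl
  xor-∧ false false z = ≡.refl

∩-swap : ∀ {n} (A B S : Subset n) → A ∩ (B ∩ S) ≡ B ∩ (A ∩ S)
∩-swap A B S = ≡.trans (≡.sym (∩-assoc A B S))
  (≡.trans (cong (_∩ S) (∩-comm A B)) (∩-assoc B A S))

module _ {ℓ ℓ₁ ℓ₂} (F : OrderedField ℓ ℓ₁ ℓ₂) where
  open OrderedField F
  open CommutativeRing commutativeRing
    using ( semiring; +-commutativeSemigroup; reflexive; sym; trans
          ; +-cong; +-congˡ; +-congʳ; +-assoc; +-comm; +-identityˡ; +-identityʳ
          ; *-congˡ; *-congʳ; *-assoc; *-comm; *-identityˡ
          ; distribˡ; distribʳ; zeroʳ; -‿inverseˡ; -‿inverseʳ)
  open CommutativeSemigroup +-commutativeSemigroup using (interchange)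
  open Sum semiring using (sum; sum-cong-≋; ∑-distrib-+; *-distribˡ-sum)
  open Max totalOrder using (⊔-cong; ⊔-sel; x≤x⊔y; x≤y⊔x)
  private module O = TotalOrder totalOrder
  open ≤-Reasoning O.poset

  -- Arithmetic in an ordered field.

  +-mono-≤ : ∀ {x y u v} → x ≤ y → u ≤ v → x + u ≤ y + v
  +-mono-≤ {x} {y} {u} {v} x≤y u≤v = begin
    x + u   ≤⟨ +-monoʳ-≤ x u≤v ⟩
    x + v   ≈⟨ +-comm x v ⟩
    v + x   ≤⟨ +-monoʳ-≤ v x≤y ⟩
    v + y   ≈⟨ +-comm v y ⟩
    y + v   ∎

  x≤x+y : ∀ {x y} → 0# ≤ y → x ≤ x + y
  x≤x+y {x} {y} 0≤y = begin
    x        ≈⟨ +-identityʳ x ⟨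
    x + 0#   ≤⟨ +-monoʳ-≤ x 0≤y ⟩
    x + y    ∎

  x≤y+x : ∀ {x y} → 0# ≤ y → x ≤ y + x
  x≤y+x {x} {y} 0≤y = begin
    x       ≤⟨ x≤x+y 0≤y ⟩
    x + y   ≈⟨ +-comm x y ⟩
    y + x   ∎

  -- The difference of the two products is `x * (- y + z)`, a product of nonnegative factors.
  *-monoʳ-≤-nonNeg : ∀ {x y z} → 0# ≤ x → y ≤ z → x * y ≤ x * z
  *-monoʳ-≤-nonNeg {x} {y} {z} 0≤x y≤z = begin
    x * y                        ≤⟨ x≤x+y (*-nonNeg 0≤x 0≤z-y) ⟩
    x * y + x * (- y + z)        ≈⟨ distribˡ x y (- y + z) ⟨
    x * (y + (- y + z))          ≈⟨ *-congˡ (+-assoc y (- y) z) ⟨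
    x * ((y + - y) + z)          ≈⟨ *-congˡ (+-congʳ (-‿inverseʳ y)) ⟩
    x * (0# + z)                 ≈⟨ *-congˡ (+-identityˡ z) ⟩
    x * z                        ∎
    where
    0≤z-y : 0# ≤ - y + z
    0≤z-y = begin
      0#        ≈⟨ -‿inverseˡ y ⟨
      - y + y   ≤⟨ +-monoʳ-≤ (- y) y≤z ⟩
      - y + z   ∎

  2*x≈x+x : ∀ x → 2# * x ≈ x + x
  2*x≈x+x x = begin-equality
    (1# + 1#) * x     ≈⟨ distribʳ x 1# 1# ⟩
    1# * x + 1# * x   ≈⟨ +-cong (*-identityˡ x) (*-identityˡ x) ⟩
    x + x             ∎

  3*x≈x+x+x : ∀ x → 3# * x ≈ (x + x) + x
  3*x≈x+x+x x = begin-equality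
    (2# + 1#) * x     ≈⟨ distribʳ x 2# 1# ⟩
    2# * x + 1# * x   ≈⟨ +-cong (2*x≈x+x x) (*-identityˡ x) ⟩
    (x + x) + x       ∎

  ½*[x+x]≈x : ∀ x → ½ * (x + x) ≈ x
  ½*[x+x]≈x x = begin-equality
    ½ * (x + x)    ≈⟨ *-congˡ (2*x≈x+x x) ⟨
    ½ * (2# * x)   ≈⟨ *-assoc ½ 2# x ⟨
    (½ * 2#) * x   ≈⟨ *-congʳ (proj₁ (proj₂ (≉0⇒invertible 2≉0))) ⟩
    1# * x         ≈⟨ *-identityˡ x ⟩
    x              ∎

  0≤½ : 0# ≤ ½
  0≤½ with O.total 0# ½
  ... | inj₁ 0≤½ = 0≤½
  -- Here `½ ≤ 0#` would make 1 = ½ + ½ at most ½, so `0≤1` yields the claim in this case too.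
  ... | inj₂ ½≤0 = begin
    0#        ≤⟨ 0≤1 ⟩
    1#        ≈⟨ ½*[x+x]≈x 1# ⟨
    ½ * 2#    ≈⟨ *-comm ½ 2# ⟩
    2# * ½    ≈⟨ 2*x≈x+x ½ ⟩
    ½ + ½     ≤⟨ +-monoʳ-≤ ½ ½≤0 ⟩
    ½ + 0#    ≈⟨ +-identityʳ ½ ⟩
    ½         ∎

  -- Finite sums over indices and over lists.

  sum-mono-≤ : ∀ {n} {f g : Fin n → Carrier} → (∀ i → f i ≤ g i) → sum f ≤ sum g
  sum-mono-≤ {zero}  f≤g = O.refl
  sum-mono-≤ {suc n} f≤g = +-mono-≤ (f≤g zero) (sum-mono-≤ (f≤g ∘ suc))

  sum-nonNeg : ∀ {n} {f : Fin n → Carrier} → (∀ i → 0# ≤ f i) → 0# ≤ sum f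
  sum-nonNeg {zero}  0≤f = O.refl
  sum-nonNeg {suc n} 0≤f = O.trans (sum-nonNeg (0≤f ∘ suc)) (x≤y+x (0≤f zero))

  -- `𝔼` unfolds to such a sum over `allSubsets`, so the lemmas below apply to it directly.
  listSum : ∀ {a} {A : Set a} → (A → Carrier) → List A → Carrier
  listSum f xs = foldr _+_ 0# (map f xs)

  listSum-++ : ∀ {a} {A : Set a} (f : A → Carrier) xs ys →
               listSum f (xs ++ ys) ≈ listSum f xs + listSum f ys
  listSum-++ f []       ys = sym (+-identityˡ (listSum f ys))
  listSum-++ f (x ∷ xs) ys = trans (+-congˡ (listSum-++ f xs ys)) (sym (+-assoc _ _ _))

  listSum-map : ∀ {a b} {A : Set a} {B : Set b} (f : B → Carrier) (h : A → B) xs →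
                listSum f (map h xs) ≡ listSum (f ∘ h) xs
  listSum-map f h xs = cong (foldr _+_ 0#) (≡.sym (map-∘ xs))

  -- The bracketing is that of `Pr` on a nonempty vector, where `k` is the factor contributed by the
  -- first job.
  listSum-scale : ∀ {a} {A : Set a} k (p X : A → Carrier) xs →
                  listSum (λ x → (k * p x) * X x) xs ≈ k * listSum (λ x → p x * X x) xs
  listSum-scale k p X []       = sym (zeroʳ k)
  listSum-scale k p X (x ∷ xs) =
    trans (+-cong (*-assoc k (p x) (X x)) (listSum-scale k p X xs)) (sym (distribˡ k _ _))

  -- Expectation over a uniformly random partition.

  -- Conditioning on the machine of the first job: by independence its probability ½ factors out of
  -- `Pr`. The properties of `𝔼` below follow from this by induction on the number of jobs.
  𝔼-suc : ∀ {n} (X : Subset (suc n) → Carrier) →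
          𝔼 F X ≈ ½ * (𝔼 F (X ∘ (inside ∷_)) + 𝔼 F (X ∘ (outside ∷_)))
  𝔼-suc {n} X = begin-equality
    listSum f (map (inside ∷_) As ++ map (outside ∷_) As)
      ≈⟨ listSum-++ f (map (inside ∷_) As) (map (outside ∷_) As) ⟩
    listSum f (map (inside ∷_) As) + listSum f (map (outside ∷_) As)
      ≡⟨ cong₂ _+_ (listSum-map f (inside ∷_) As) (listSum-map f (outside ∷_) As) ⟩
    listSum (f ∘ (inside ∷_)) As + listSum (f ∘ (outside ∷_)) As
      ≈⟨ +-cong (listSum-scale ½ (Pr F) (X ∘ (inside ∷_)) As)
                (listSum-scale ½ (Pr F) (X ∘ (outside ∷_)) As) ⟩
    ½ * 𝔼 F (X ∘ (inside ∷_)) + ½ * 𝔼 F (X ∘ (outside ∷_))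
      ≈⟨ distribˡ ½ _ _ ⟨
    ½ * (𝔼 F (X ∘ (inside ∷_)) + 𝔼 F (X ∘ (outside ∷_)))
      ∎
    where
    As = allSubsets n
    f : Subset (suc n) → Carrier
    f A = Pr F A * X A

  𝔼-zero : (X : Subset 0 → Carrier) → 𝔼 F X ≈ X []
  𝔼-zero X = trans (+-identityʳ _) (*-identityˡ (X []))

  𝔼-mono-≤ : ∀ {n} {X Y : Subset n → Carrier} → (∀ A → X A ≤ Y A) → 𝔼 F X ≤ 𝔼 F Y
  𝔼-mono-≤ {zero} {X} {Y} X≤Y = begin
    𝔼 F X   ≈⟨ 𝔼-zero X ⟩
    X []    ≤⟨ X≤Y [] ⟩
    Y []    ≈⟨ 𝔼-zero Y ⟨
    𝔼 F Y   ∎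
  𝔼-mono-≤ {suc n} {X} {Y} X≤Y = begin
    𝔼 F X   ≈⟨ 𝔼-suc X ⟩
    ½ * (𝔼 F (X ∘ (inside ∷_)) + 𝔼 F (X ∘ (outside ∷_)))
      ≤⟨ *-monoʳ-≤-nonNeg 0≤½ (+-mono-≤ (𝔼-mono-≤ (X≤Y ∘ (inside ∷_)))
                                        (𝔼-mono-≤ (X≤Y ∘ (outside ∷_)))) ⟩
    ½ * (𝔼 F (Y ∘ (inside ∷_)) + 𝔼 F (Y ∘ (outside ∷_)))
      ≈⟨ 𝔼-suc Y ⟨
    𝔼 F Y   ∎

  𝔼-+ : ∀ {n} (X Y : Subset n → Carrier) → 𝔼 F (λ A → X A + Y A) ≈ 𝔼 F X + 𝔼 F Y
  𝔼-+ {zero}  X Y =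
    trans (𝔼-zero (λ A → X A + Y A)) (sym (+-cong (𝔼-zero X) (𝔼-zero Y)))
  𝔼-+ {suc n} X Y = begin-equality
    𝔼 F (λ A → X A + Y A)
      ≈⟨ 𝔼-suc (λ A → X A + Y A) ⟩
    ½ * (𝔼 F (λ A → Xᵢ A + Yᵢ A) + 𝔼 F (λ A → Xₒ A + Yₒ A))
      ≈⟨ *-congˡ (+-cong (𝔼-+ Xᵢ Yᵢ) (𝔼-+ Xₒ Yₒ)) ⟩
    ½ * ((𝔼 F Xᵢ + 𝔼 F Yᵢ) + (𝔼 F Xₒ + 𝔼 F Yₒ))
      ≈⟨ *-congˡ (interchange _ _ _ _) ⟩
    ½ * ((𝔼 F Xᵢ + 𝔼 F Xₒ) + (𝔼 F Yᵢ + 𝔼 F Yₒ))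
      ≈⟨ distribˡ ½ _ _ ⟩
    ½ * (𝔼 F Xᵢ + 𝔼 F Xₒ) + ½ * (𝔼 F Yᵢ + 𝔼 F Yₒ)
      ≈⟨ +-cong (𝔼-suc X) (𝔼-suc Y) ⟨
    𝔼 F X + 𝔼 F Y
      ∎
    where
    Xᵢ Xₒ Yᵢ Yₒ : Subset n → Carrier
    Xᵢ = X ∘ (inside ∷_)
    Xₒ = X ∘ (outside ∷_)
    Yᵢ = Y ∘ (inside ∷_)
    Yₒ = Y ∘ (outside ∷_)

  -- This expresses that the probabilities of all outcomes add up to 1.
  𝔼-const : ∀ n x → 𝔼 F {n} (λ _ → x) ≈ x
  𝔼-const zero    x = 𝔼-zero (λ _ → x)
  𝔼-const (suc n) x = trans (𝔼-suc {n} (λ _ → x))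
    (trans (*-congˡ (+-cong (𝔼-const n x) (𝔼-const n x))) (½*[x+x]≈x x))

  -- If the first job lies in `B`, the two conditional expectations of `𝔼-suc` trade places;
  -- otherwise they keep them. Both carry the same weight ½, so the expectation is unchanged.
  𝔼-⊕ : ∀ {n} (X : Subset n → Carrier) B → 𝔼 F (λ A → X (A ⊕ B)) ≈ 𝔼 F X
  𝔼-⊕ X [] = trans (𝔼-zero (λ A → X (A ⊕ []))) (sym (𝔼-zero X))
  𝔼-⊕ X (inside ∷ B) = begin-equality
    𝔼 F (λ A → X (A ⊕ (inside ∷ B)))
      ≈⟨ 𝔼-suc (λ A → X (A ⊕ (inside ∷ B))) ⟩
    ½ * (𝔼 F (λ A → X (outside ∷ A ⊕ B)) + 𝔼 F (λ A → X (inside ∷ A ⊕ B)))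
      ≈⟨ *-congˡ (+-cong (𝔼-⊕ (X ∘ (outside ∷_)) B) (𝔼-⊕ (X ∘ (inside ∷_)) B)) ⟩
    ½ * (𝔼 F (X ∘ (outside ∷_)) + 𝔼 F (X ∘ (inside ∷_)))
      ≈⟨ *-congˡ (+-comm _ _) ⟩
    ½ * (𝔼 F (X ∘ (inside ∷_)) + 𝔼 F (X ∘ (outside ∷_)))
      ≈⟨ 𝔼-suc X ⟨
    𝔼 F X
      ∎
  𝔼-⊕ X (outside ∷ B) = begin-equality
    𝔼 F (λ A → X (A ⊕ (outside ∷ B)))
      ≈⟨ 𝔼-suc (λ A → X (A ⊕ (outside ∷ B))) ⟩
    ½ * (𝔼 F (λ A → X (inside ∷ A ⊕ B)) + 𝔼 F (λ A → X (outside ∷ A ⊕ B)))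
      ≈⟨ *-congˡ (+-cong (𝔼-⊕ (X ∘ (inside ∷_)) B) (𝔼-⊕ (X ∘ (outside ∷_)) B)) ⟩
    ½ * (𝔼 F (X ∘ (inside ∷_)) + 𝔼 F (X ∘ (outside ∷_)))
      ≈⟨ 𝔼-suc X ⟨
    𝔼 F X
      ∎

  -- Since `X A` and `X (A ⊕ B)` have equal expectations, `𝔼 F X` is half the expectation of their
  -- sum.
  𝔼-pairing : ∀ {n} (X : Subset n → Carrier) B v →
              (∀ A → X A + X (A ⊕ B) ≤ v) → 𝔼 F X ≤ ½ * v
  𝔼-pairing {n} X B v X+X⊕B≤v = begin
    𝔼 F X                                     ≈⟨ ½*[x+x]≈x (𝔼 F X) ⟨
    ½ * (𝔼 F X + 𝔼 F X)                       ≈⟨ *-congˡ (+-congˡ (𝔼-⊕ X B)) ⟨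
    ½ * (𝔼 F X + 𝔼 F (λ A → X (A ⊕ B)))       ≈⟨ *-congˡ (𝔼-+ X (λ A → X (A ⊕ B))) ⟨
    ½ * 𝔼 F (λ A → X A + X (A ⊕ B))           ≤⟨ *-monoʳ-≤-nonNeg 0≤½ (𝔼-mono-≤ X+X⊕B≤v) ⟩
    ½ * 𝔼 F {n} (λ _ → v)                     ≈⟨ *-congˡ (𝔼-const n v) ⟩
    ½ * v                                     ∎

  -- Machine loads in one scenario.

  -- This is `totalTime` freed from the instance, so that induction can pass to the remaining jobs
  -- with `t ∘ suc`.
  load : ∀ {n} → (Fin n → Carrier) → Subset n → Carrier
  load t S = sum λ j → if lookup S j then t j else 0#

  load-nonNeg : ∀ {n} {t : Fin n → Carrier} → (∀ j → 0# ≤ t j) → ∀ S → 0# ≤ load t S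
  load-nonNeg {t = t} 0≤t S = sum-nonNeg λ j → if-nonNeg (lookup S j) (0≤t j)
    where
    if-nonNeg : ∀ b {x} → 0# ≤ x → 0# ≤ (if b then x else 0#)
    if-nonNeg true  0≤x = 0≤x
    if-nonNeg false _   = O.refl

  load-partition : ∀ {n} (t : Fin n → Carrier) A S →
                   load t (A ∩ S) + load t (∁ A ∩ S) ≈ load t S
  load-partition t []      []      = +-identityˡ 0#
  load-partition t (a ∷ A) (s ∷ S) = trans (interchange _ _ _ _)
    (+-cong (if-partition a s) (load-partition (t ∘ suc) A S))
    where
    if-partition : ∀ x y {z} → (if x ∧ y then z else 0#) + (if not x ∧ y then z else 0#)
                               ≈ (if y then z else 0#)
    if-partition true  y = +-identityʳ _
    if-partition false y = +-identityˡ _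

  -- Here `B` does the cutting; `∩-swap` then moves it inward, so that the pieces match those in
  -- `load-⊕`.
  load-split : ∀ {n} (t : Fin n → Carrier) A B S →
               load t (A ∩ S) ≈ load t (A ∩ (B ∩ S)) + load t (A ∩ (∁ B ∩ S))
  load-split t A B S = trans (sym (load-partition t B (A ∩ S)))
    (reflexive (cong₂ (λ U V → load t U + load t V) (∩-swap B A S) (∩-swap (∁ B) A S)))

  -- After the move, machine 1 holds the jobs of `B` that were on machine 2 and the jobs of `∁ B`
  -- that it held before.
  load-⊕ : ∀ {n} (t : Fin n → Carrier) A B S →
           load t ((A ⊕ B) ∩ S) ≈ load t (∁ A ∩ (B ∩ S)) + load t (A ∩ (∁ B ∩ S))
  load-⊕ t A B S = trans (load-split t (A ⊕ B) B S)
    (reflexive (cong₂ (λ U V → load t U + load t V) (⊕-∩-inside A B S) (⊕-∩-outside A B S)))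

  load-∁⊕ : ∀ {n} (t : Fin n → Carrier) A B S →
            load t (∁ (A ⊕ B) ∩ S) ≈ load t (A ∩ (B ∩ S)) + load t (∁ A ∩ (∁ B ∩ S))
  -- Machine 2 after the move is machine 1 for the partition started from `∁ A`; the double
  -- complement this creates is then removed.
  load-∁⊕ t A B S rewrite ∁-⊕ A B = trans (load-⊕ t (∁ A) B S)
    (+-congʳ (reflexive (cong (λ U → load t (U ∩ (B ∩ S))) (∁-involutive A))))

  -- In the application, a and b are the loads that A and ∁ A receive from B, and
  -- c and d those that they receive from ∁ B.
  max-pair : ∀ {a b c d m} → 0# ≤ a → 0# ≤ b → 0# ≤ c → 0# ≤ d →
             a + b ≤ m → c + d ≤ m →
             max (a + c) (b + d) + max (b + c) (a + d) ≤ 3# * m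
  max-pair {a} {b} {c} {d} {m} 0≤a 0≤b 0≤c 0≤d a+b≤m c+d≤m
    with ⊔-sel (a + c) (b + d) | ⊔-sel (b + c) (a + d)
  ... | inj₁ p | inj₁ q = begin
    max (a + c) (b + d) + max (b + c) (a + d) ≈⟨ +-cong p q ⟩
    (a + c) + (b + c)   ≈⟨ interchange a c b c ⟩
    (a + b) + (c + c)   ≈⟨ +-comm _ _ ⟩
    (c + c) + (a + b)   ≤⟨ +-mono-≤ (+-mono-≤ c≤m c≤m) a+b≤m ⟩
    (m + m) + m         ≈⟨ 3*x≈x+x+x m ⟨
    3# * m              ∎
    where c≤m = O.trans (x≤x+y 0≤d) c+d≤m
  ... | inj₁ p | inj₂ q = begin
    max (a + c) (b + d) + max (b + c) (a + d) ≈⟨ +-cong p q ⟩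
    (a + c) + (a + d)   ≈⟨ interchange a c a d ⟩
    (a + a) + (c + d)   ≤⟨ +-mono-≤ (+-mono-≤ a≤m a≤m) c+d≤m ⟩
    (m + m) + m         ≈⟨ 3*x≈x+x+x m ⟨
    3# * m              ∎
    where a≤m = O.trans (x≤x+y 0≤b) a+b≤m
  ... | inj₂ p | inj₁ q = begin
    max (a + c) (b + d) + max (b + c) (a + d) ≈⟨ +-cong p q ⟩
    (b + d) + (b + c)   ≈⟨ interchange b d b c ⟩
    (b + b) + (d + c)   ≈⟨ +-congˡ (+-comm d c) ⟩
    (b + b) + (c + d)   ≤⟨ +-mono-≤ (+-mono-≤ b≤m b≤m) c+d≤m ⟩
    (m + m) + m         ≈⟨ 3*x≈x+x+x m ⟨
    3# * m              ∎
    where b≤m = O.trans (x≤y+x 0≤a) a+b≤m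
  ... | inj₂ p | inj₂ q = begin
    max (a + c) (b + d) + max (b + c) (a + d) ≈⟨ +-cong p q ⟩
    (b + d) + (a + d)   ≈⟨ interchange b d a d ⟩
    (b + a) + (d + d)   ≈⟨ +-comm _ _ ⟩
    (d + d) + (b + a)   ≈⟨ +-congˡ (+-comm b a) ⟩
    (d + d) + (a + b)   ≤⟨ +-mono-≤ (+-mono-≤ d≤m d≤m) a+b≤m ⟩
    (m + m) + m         ≈⟨ 3*x≈x+x+x m ⟨
    3# * m              ∎
    where d≤m = O.trans (x≤y+x 0≤c) c+d≤m

  -- Makespans in one scenario.

  makespan : ∀ {n} → (Fin n → Carrier) → Subset n → Subset n → Carrier
  makespan t S A = max (load t (A ∩ S)) (load t (∁ A ∩ S))

  makespan-pair : ∀ {n} {t : Fin n → Carrier} → (∀ j → 0# ≤ t j) → ∀ S A B →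
                  makespan t S A + makespan t S (A ⊕ B) ≤ 3# * makespan t S B
  makespan-pair {t = t} 0≤t S A B = begin
    makespan t S A + makespan t S (A ⊕ B)
      -- The machines carry `a + c` and `b + d` before the move, `b + c` and `a + d` after it.
      ≈⟨ +-cong (⊔-cong (load-split t A B S) (load-split t (∁ A) B S))
                (⊔-cong (load-⊕ t A B S) (load-∁⊕ t A B S)) ⟩
    max (a + c) (b + d) + max (b + c) (a + d)
      ≤⟨ max-pair (0≤load (A ∩ (B ∩ S))) (0≤load (∁ A ∩ (B ∩ S)))
                  (0≤load (A ∩ (∁ B ∩ S))) (0≤load (∁ A ∩ (∁ B ∩ S))) a+b≤m c+d≤m ⟩
    3# * makespan t S B
      ∎
    where
    a b c d : Carrier
    a = load t (A ∩ (B ∩ S))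
    b = load t (∁ A ∩ (B ∩ S))
    c = load t (A ∩ (∁ B ∩ S))
    d = load t (∁ A ∩ (∁ B ∩ S))

    0≤load : ∀ U → 0# ≤ load t U
    0≤load = load-nonNeg 0≤t

    -- `a + b` and `c + d` are the loads of the two machines under the partition given by `B`, so
    -- its makespan bounds both.
    a+b≤m : a + b ≤ makespan t S B
    a+b≤m = O.trans (O.reflexive (load-partition t A (B ∩ S))) (x≤x⊔y _ _)

    c+d≤m : c + d ≤ makespan t S B
    c+d≤m = O.trans (O.reflexive (load-partition t A (∁ B ∩ S))) (x≤y⊔x _ _)

  -- All scenarios together, and comparison with the optimum.

  module _ (I : SM2 F) where
    open SM2 I

    -- One move by `B` serves all scenarios at once, so the inequalities for single scenarios add
    -- up.
    sumOfMakespans-pair : ∀ A B →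
      sumOfMakespans A + sumOfMakespans (A ⊕ B) ≤ 3# * sumOfMakespans B
    sumOfMakespans-pair A B = begin
      sum (m A) + sum (m (A ⊕ B))
        ≈⟨ ∑-distrib-+ (m A) (m (A ⊕ B)) ⟨
      sum (λ i → m A i + m (A ⊕ B) i)
        ≤⟨ sum-mono-≤ (λ i → makespan-pair time-nonNeg (scenario i) A B) ⟩
      sum (λ i → 3# * m B i)
        ≈⟨ *-distribˡ-sum 3# (m B) ⟨
      3# * sum (m B)
        ∎
      where
      m : Subset #jobs → Fin #scenarios → Carrier
      m A i = makespan time (scenario i) A

    𝔼-sumOfMakespans-≤ : ∀ B → 𝔼 F sumOfMakespans ≤ (3# * ½) * sumOfMakespans B
    𝔼-sumOfMakespans-≤ B = begin
      𝔼 F sumOfMakespans             ≤⟨ 𝔼-pairing sumOfMakespans B _ (λ A → sumOfMakespans-pair A B) ⟩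
      ½ * (3# * sumOfMakespans B)    ≈⟨ *-assoc ½ 3# _ ⟨
      (½ * 3#) * sumOfMakespans B    ≈⟨ *-congʳ (*-comm ½ 3#) ⟩
      (3# * ½) * sumOfMakespans B    ∎

theorem6 : ∀ {c ℓ₁ ℓ₂} (F : OrderedField c ℓ₁ ℓ₂) (I : SM2 F) →
    let open OrderedField F
        open SM2 I
    in 𝔼 F sumOfMakespans ≤ (3# * ½) * optimalValue
-- The bound holds against every partition, hence against the minimum, and no optimal partition has
-- to be singled out.
theorem6 F I = Extrema.argmin-all totalOrder id
  {P = λ v → 𝔼 F sumOfMakespans ≤ (3# * ½) * v}
  -- The default value of the minimum is the cost of `∅`, so it obeys the same bound.
  (𝔼-sumOfMakespans-≤ F I ∅)
  (All.map⁺ (universal (𝔼-sumOfMakespans-≤ F I) (allSubsets #jobs)))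
  where
  open OrderedField F
  open SM2 I
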